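{- For every integer $n>0$, $$A(n)=B(n)=C(n+1)=\tfrac12 D(n+1)=E(n+2)=F(n+1).$$
   Context: The partition functions are defined as follows. - $A(n)$ is the number of partitions of $n$ into distinct parts. - $B(n)$ is the number of partitions of $n$ into odd parts. - $C(n)$ is the number of partitions of $n$ whose largest part is even and whose parts not exceeding half of the largest part are distinct. - $D(n)$ is the number of partitions of $n$ into non-negative parts (part $0$ allowed) in which the smallest part appears exactly twice and no other part is repeated. - $E(n)$ is the number of partitions of $n$ in which all parts are odd and the largest part appears exactly once. - $F(n)$ is the number of partitions of $n$ whose largest part is even and appears exactly once, all other parts being odd. -}

module Defs where

open import Data.List.Base using (List; []; _∷_; length; filter; upTo; cartesianProductWith)
open import Data.List.Membership.Propositional using (_∈_; find; lose)
open import Data.List.Membership.Propositional.Properties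
  using (∈-cartesianProductWith⁺; ∈-cartesianProductWith⁻; ∈-upTo⁺; ∈-filter⁺; ∈-filter⁻)
open import Data.List.Properties using (∷-injective)
open import Data.List.Relation.Unary.All as All using (All; []; _∷_; all?)
open import Data.List.Relation.Unary.AllPairs using ([]; _∷_)
open import Data.List.Relation.Unary.Any using (here; there; any?)
open import Data.List.Relation.Unary.Linked using (Linked; linked?)
open import Data.List.Relation.Unary.Unique.Propositional using (Unique)
open import Data.List.Relation.Unary.Unique.Propositional.Properties
  using (upTo⁺; filter⁺; cartesianProductWith⁺)
open import Data.Nat.Base using (ℕ; zero; suc; _+_; _*_; _≤_; _<_; _≥_; z≤n; s≤s)
open import Data.Nat.Divisibility using (_∣_; _∤_; _∣?_)
open import Data.Nat.ListAction using (sum)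
open import Data.Nat.Properties
open import Data.Product.Base using (_×_; _,_; ∃; proj₁; proj₂)
open import Function.Bundles using (_⇔_; mk⇔)
open import Relation.Binary.PropositionalEquality using (_≡_; _≢_; refl; sym; subst)
open import Relation.Nullary using (Dec; ¬?)
open import Relation.Nullary.Decidable using (map′; _×-dec_; _→-dec_)
open import Relation.Unary using (Pred; Decidable)
open import Level using (0ℓ)
import Data.List.Relation.Unary.Unique.DecPropositional _≟_ as DecUnique

-- Partitions are weakly decreasing lists of parts; the subscript ₀ allows
-- the part 0.
IsPartition₀ : ℕ → List ℕ → Set
IsPartition₀ n p = Linked _≥_ p × sum p ≡ n

IsPartition : ℕ → List ℕ → Set
IsPartition n p = IsPartition₀ n p × All (0 <_) p

Even Odd : ℕ → Set
Even n = 2 ∣ n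
Odd  n = 2 ∤ n

multiplicity : ℕ → List ℕ → ℕ
multiplicity x p = length (filter (x ≟_) p)

IsLargest IsSmallest : List ℕ → ℕ → Set
IsLargest  p m = m ∈ p × All (_≤ m) p
IsSmallest p m = m ∈ p × All (m ≤_) p

PartA PartB PartC PartD PartE PartF : ℕ → List ℕ → Set

PartA n p = IsPartition n p × Unique p

PartB n p = IsPartition n p × All Odd p

PartC n p = IsPartition n p ×
  ∃ λ m → IsLargest p m × Even m × Unique (filter (λ x → 2 * x ≤? m) p)

PartD n p = IsPartition₀ n p ×
  ∃ λ m → IsSmallest p m × multiplicity m p ≡ 2
        × All (λ x → x ≢ m → multiplicity x p ≡ 1) p

PartE n p = IsPartition n p × All Odd p ×
  ∃ λ m → IsLargest p m × multiplicity m p ≡ 1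

PartF n p = IsPartition n p ×
  ∃ λ m → IsLargest p m × Even m × multiplicity m p ≡ 1
        × All (λ x → x ≢ m → Odd x) p

-- Cardinality: `length (elements e)` does not depend on the choice of
-- e : Enumeration P, since any two such lists are permutations of each other.
record Enumeration {X : Set} (P : Pred X 0ℓ) : Set where
  field
    elements : List X
    unique   : Unique elements
    ∈⇔       : ∀ {x} → x ∈ elements ⇔ P x

open Enumeration public

card : {X : Set} {P : Pred X 0ℓ} → Enumeration P → ℕ
card e = length (elements e)

∃-part? : ∀ p {Q R : ℕ → Set} → Decidable Q → Decidable R →
          Dec (∃ λ m → (m ∈ p × Q m) × R m)
∃-part? p Q? R? = map′
  (λ a → let m , m∈p , qr = find a in m , (m∈p , proj₁ qr) , proj₂ qr)
  (λ (m , (m∈p , q) , r) → lose m∈p (q , r))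
  (any? (λ m → Q? m ×-dec R? m) p)

isPartition₀? : ∀ n → Decidable (IsPartition₀ n)
isPartition₀? n p = linked? _≥?_ p ×-dec (sum p ≟ n)

isPartition? : ∀ n → Decidable (IsPartition n)
isPartition? n p = isPartition₀? n p ×-dec all? (0 <?_) p

odd? : Decidable Odd
odd? n = ¬? (2 ∣? n)

partA? : ∀ n → Decidable (PartA n)
partA? n p = isPartition? n p ×-dec DecUnique.unique? p

partB? : ∀ n → Decidable (PartB n)
partB? n p = isPartition? n p ×-dec all? odd? p

partC? : ∀ n → Decidable (PartC n)
partC? n p = isPartition? n p ×-dec ∃-part? p (λ m → all? (_≤? m) p)
  (λ m → 2 ∣? m ×-dec DecUnique.unique? (filter (λ x → 2 * x ≤? m) p))

partD? : ∀ n → Decidable (PartD n)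
partD? n p = isPartition₀? n p ×-dec ∃-part? p (λ m → all? (m ≤?_) p)
  (λ m → multiplicity m p ≟ 2
    ×-dec all? (λ x → ¬? (x ≟ m) →-dec (multiplicity x p ≟ 1)) p)

partE? : ∀ n → Decidable (PartE n)
partE? n p = isPartition? n p ×-dec all? odd? p ×-dec
  ∃-part? p (λ m → all? (_≤? m) p) (λ m → multiplicity m p ≟ 1)

partF? : ∀ n → Decidable (PartF n)
partF? n p = isPartition? n p ×-dec ∃-part? p (λ m → all? (_≤? m) p)
  (λ m → 2 ∣? m ×-dec multiplicity m p ≟ 1
    ×-dec all? (λ x → ¬? (x ≟ m) →-dec odd? x) p)

-- Finiteness: every partition of n considered here has at most 2 + n parts
-- (in PartD the part 0 may occur twice), each at most n.
InBox : ℕ → ℕ → List ℕ → Set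
InBox l m p = length p ≤ l × All (_≤ m) p

box : ℕ → ℕ → List (List ℕ)
box zero    m = [] ∷ []
box (suc l) m = [] ∷ cartesianProductWith _∷_ (upTo (suc m)) (box l m)

box-unique : ∀ l m → Unique (box l m)
box-unique zero    m = [] ∷ []
box-unique (suc l) m =
  All.tabulate (λ {p} p∈ → nonempty (∈-cartesianProductWith⁻ _∷_ (upTo (suc m)) (box l m) p∈))
  ∷ cartesianProductWith⁺ _∷_ ∷-injective (upTo⁺ (suc m)) (box-unique l m)
  where
  nonempty : ∀ {p} {S : ℕ → List ℕ → Set} {T : ℕ → List ℕ → Set} →
             (∃ λ x → ∃ λ q → S x q × T x q × p ≡ x ∷ q) → [] ≢ p
  nonempty (_ , _ , _ , _ , refl) ()

∈-box : ∀ l m p → InBox l m p → p ∈ box l m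
∈-box zero    m []      _                      = here refl
∈-box (suc l) m []      _                      = here refl
∈-box (suc l) m (x ∷ p) (s≤s |p|≤l , x≤m ∷ p≤m) =
  there (∈-cartesianProductWith⁺ _∷_ (∈-upTo⁺ (s≤s x≤m)) (∈-box l m p (|p|≤l , p≤m)))

enumerate : ∀ {P : Pred (List ℕ) 0ℓ} → Decidable P → ∀ l m →
            (∀ p → P p → InBox l m p) → Enumeration P
enumerate P? l m bound = record
  { elements = filter P? (box l m)
  ; unique   = filter⁺ P? (box-unique l m)
  ; ∈⇔       = λ {p} → mk⇔ (λ p∈ → proj₂ (∈-filter⁻ P? {xs = box l m} p∈))
                   (λ Pp → ∈-filter⁺ P? (∈-box l m p (bound p Pp)) Pp)
  }

part≤sum : ∀ p → All (_≤ sum p) p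
part≤sum []      = []
part≤sum (x ∷ p) = m≤m+n x (sum p) ∷ All.map (λ y≤ → ≤-trans y≤ (m≤n+m (sum p) x)) (part≤sum p)

length≤sum : ∀ {p} → All (0 <_) p → length p ≤ sum p
length≤sum []        = z≤n
length≤sum (0<x ∷ a) = +-mono-≤ 0<x (length≤sum a)

length≤zeros+sum : ∀ p → length p ≤ multiplicity 0 p + sum p
length≤zeros+sum []          = z≤n
length≤zeros+sum (zero  ∷ p) = s≤s (length≤zeros+sum p)
length≤zeros+sum (suc x ∷ p) = begin
  suc (length p)                      ≤⟨ s≤s (length≤zeros+sum p) ⟩
  suc (multiplicity 0 p + sum p)      ≡⟨ sym (+-suc (multiplicity 0 p) (sum p)) ⟩
  multiplicity 0 p + suc (sum p)      ≤⟨ +-monoʳ-≤ (multiplicity 0 p) (s≤s (m≤n+m (sum p) x)) ⟩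
  multiplicity 0 p + (suc x + sum p)  ∎
  where open ≤-Reasoning

inBox : ∀ {n} p → IsPartition n p → InBox (2 + n) n p
inBox p ((_ , refl) , 0<p) = ≤-trans (length≤sum 0<p) (m≤n+m (sum p) 2) , part≤sum p

inBoxD : ∀ n p → PartD n p → InBox (2 + n) n p
inBoxD n p (p⊢n , zero , _ , twice , _) rewrite sym (proj₂ p⊢n) =
  subst (λ k → length p ≤ k + sum p) twice (length≤zeros+sum p) , part≤sum p
inBoxD n p (p⊢n , suc m , (_ , m≤p) , _) =
  inBox p (p⊢n , All.map (≤-trans (s≤s z≤n)) m≤p)

enumA : ∀ n → Enumeration (PartA n)
enumA n = enumerate (partA? n) (2 + n) n (λ p (h , _) → inBox p h)

enumB : ∀ n → Enumeration (PartB n)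
enumB n = enumerate (partB? n) (2 + n) n (λ p (h , _) → inBox p h)

enumC : ∀ n → Enumeration (PartC n)
enumC n = enumerate (partC? n) (2 + n) n (λ p (h , _) → inBox p h)

enumD : ∀ n → Enumeration (PartD n)
enumD n = enumerate (partD? n) (2 + n) n (inBoxD n)

enumE : ∀ n → Enumeration (PartE n)
enumE n = enumerate (partE? n) (2 + n) n (λ p (h , _) → inBox p h)

enumF : ∀ n → Enumeration (PartF n)
enumF n = enumerate (partF? n) (2 + n) n (λ p (h , _) → inBox p h)

A B C D E F : ℕ → ℕ
A n = card (enumA n)
B n = card (enumB n)
C n = card (enumC n)
D n = card (enumD n)
E n = card (enumE n)
F n = card (enumF n)

{-# OPTIONS --safe #-}
module Submission where

-- A(n) = B(n): Glaisher's bijection, carried out one step at a time; step k splits the copies of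
-- the part k + 1 into pairs, each replaced by one part 2k + 2.
-- B(n) = F(n + 1) = E(n + 2): add 1 to the largest part, and then 1 again.
-- F = C: fix the largest part 2k and apply the first k steps of Glaisher's bijection to the other
-- parts. These are at most 2k, and after k steps the parts up to k are the ones required to be distinct.
-- 2 A(n) = D(n + 1): twice A(n) counts the partitions of n into distinct non-negative parts. Add 1
-- to the smallest part; either it becomes equal to the next one, or it stays the smallest and
-- unrepeated, and then 0 + 0 is appended.

open import Defs
open import Data.Bool.Base using (Bool; true; false)
open import Data.Empty using (⊥)
open import Data.List.Base using (List; []; _∷_; _++_; length; map; filter; replicate; cartesianProduct)
open import Data.List.Membership.Propositional using (_∈_; _∉_)
open import Data.List.Membership.Propositional.Properties
  using (∈-∃++; ∈-++⁺ˡ; ∈-++⁺ʳ; ∈-++⁻; ∈-map⁻; ∈-filter⁻; ∈-cartesianProduct⁺; ∈-cartesianProduct⁻)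
open import Data.List.Properties
  using (length-++; length-map; length-filter; filter-accept; filter-reject; filter-++)
open import Data.List.Relation.Binary.Permutation.Propositional using (_↭_)
open import Data.List.Relation.Binary.Permutation.Propositional.Properties
  using (filter-↭; ↭-length)
open import Data.List.Relation.Unary.All as All using (All; []; _∷_)
open import Data.List.Relation.Unary.AllPairs as AllPairs using (AllPairs; []; _∷_)
open import Data.List.Relation.Unary.Any using (here; there)
open import Data.List.Relation.Unary.Linked as Linked using (Linked; []; [-]; _∷_)
open import Data.List.Relation.Unary.Linked.Properties using (Linked⇒AllPairs; AllPairs⇒Linked)
open import Data.List.Relation.Unary.Unique.Propositional using (Unique)
open import Data.List.Relation.Unary.Unique.Propositional.Properties using (cartesianProduct⁺)
open import Data.Nat.Base using (ℕ; zero; suc; pred; _+_; _*_; _∸_; _>_; _<_; _≤_; _≥_; z≤n; s≤s)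
open import Data.Nat.Divisibility
  using (_∣_; divides; m∣m*n; ∣m+n∣m⇒∣n; ∣m∣n⇒∣m+n; ∣-refl; ∣1⇒≡1; _∣0)
open import Data.Nat.DivMod
  using (_/_; _%_; m≡m%n+[m/n]*n; m%n<n; [m+kn]%n≡m%n; m<n⇒m%n≡m; m/n*n≤m; m/n*n≡m; m*n/n≡m; m<n⇒m/n≡0; +-distrib-/-∣ʳ)
open import Data.Nat.ListAction using (sum)
open import Data.Nat.ListAction.Properties using (sum-++; sum-↭)
open import Data.Nat.Properties
open import Data.Product.Base using (_×_; _,_; ∃; ∃₂; proj₁; proj₂; map₂)
open import Data.Sum.Base using (_⊎_; inj₁; inj₂; [_,_]′)
open import Function.Base using (_∘_; id; case_of_)
open import Function.Bundles using (mk⇔; Equivalence)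
open import Level using (0ℓ)
open import Relation.Binary.PropositionalEquality
  using (_≡_; _≢_; refl; sym; trans; cong; cong₂; subst; ≢-sym; module ≡-Reasoning)
open import Relation.Nullary using (¬_; ¬?; yes; no; contradiction)
open import Relation.Nullary.Decidable using (_×-dec_)
open import Relation.Unary using (Pred; Decidable)
import Data.List.Sort as Sort
import Relation.Binary.Construct.Flip.EqAndOrd as Flip

open Sort (Flip.decTotalOrder ≤-decTotalOrder) using (sort; sort-↭; sort-↗)
open Equivalence using (to; from)

private variable
  X Y Z : Set
  k m n x y : ℕ
  p q : List ℕ

-- Cardinality

-- Pigeonhole by induction on `xs`: one occurrence of its head is cut out of `ys`, and the tail,
-- which avoids that head, still embeds in what remains.
unique-⊆⇒length≤ : {xs ys : List X} → Unique xs → (∀ {x} → x ∈ xs → x ∈ ys) → length xs ≤ length ys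
unique-⊆⇒length≤ [] _ = z≤n
unique-⊆⇒length≤ {xs = x ∷ xs} (x∉ ∷ u) ⊆ys with as , bs , refl ← ∈-∃++ (⊆ys (here refl)) = begin
  suc (length xs)              ≤⟨ s≤s (unique-⊆⇒length≤ u ⊆rest) ⟩
  suc (length (as ++ bs))      ≡⟨ cong suc (length-++ as) ⟩
  suc (length as + length bs)  ≡⟨ +-suc (length as) (length bs) ⟨
  length as + suc (length bs)  ≡⟨ length-++ as ⟨
  length (as ++ x ∷ bs)        ∎
  where
  open ≤-Reasoning
  ⊆rest : ∀ {y} → y ∈ xs → y ∈ as ++ bs
  ⊆rest y∈ with ∈-++⁻ as (⊆ys (there y∈))
  ... | inj₁ y∈as         = ∈-++⁺ˡ y∈as
  ... | inj₂ (here refl)  = contradiction refl (All.lookup x∉ y∈)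
  ... | inj₂ (there y∈bs) = ∈-++⁺ʳ as y∈bs

-- Injectivity is asked for on the members only, because the maps of `_≅_` are invertible only where
-- the predicates hold.
unique-map : {f : X → Y} (xs : List X) → (∀ {x y} → x ∈ xs → y ∈ xs → f x ≡ f y → x ≡ y) →
             Unique xs → Unique (map f xs)
unique-map []       inj []       = []
unique-map (x ∷ xs) inj (x∉ ∷ u) =
  All.tabulate (λ fy∈ fx≡fy → case ∈-map⁻ _ fy∈ of λ where
    (y , y∈ , refl) → All.lookup x∉ y∈ (inj (here refl) (there y∈) fx≡fy))
  ∷ unique-map xs (λ x∈ y∈ → inj (there x∈) (there y∈)) u

infix 4 _≅_
-- The maps act on all of `X` and `Y`, while the laws hold on the predicates alone. Bijections can
-- thus be plain functions on lists with arbitrary values elsewhere, and membership proofs never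
-- have to be compared.
record _≅_ {X Y : Set} (P : Pred X 0ℓ) (Q : Pred Y 0ℓ) : Set where
  field
    fwd      : X → Y
    bwd      : Y → X
    fwd-∈    : ∀ {x} → P x → Q (fwd x)
    bwd-∈    : ∀ {y} → Q y → P (bwd y)
    bwd∘fwd  : ∀ {x} → P x → bwd (fwd x) ≡ x
    fwd∘bwd  : ∀ {y} → Q y → fwd (bwd y) ≡ y

open _≅_

private variable
  P : Pred X 0ℓ
  Q : Pred Y 0ℓ
  R : Pred Z 0ℓ

≅-sym : P ≅ Q → Q ≅ P
≅-sym i = record { fwd = bwd i ; bwd = fwd i ; fwd-∈ = bwd-∈ i ; bwd-∈ = fwd-∈ i
                 ; bwd∘fwd = fwd∘bwd i ; fwd∘bwd = bwd∘fwd i }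

≅-trans : P ≅ Q → Q ≅ R → P ≅ R
≅-trans i j = record
  { fwd     = fwd j ∘ fwd i
  ; bwd     = bwd i ∘ bwd j
  ; fwd-∈   = fwd-∈ j ∘ fwd-∈ i
  ; bwd-∈   = bwd-∈ i ∘ bwd-∈ j
  ; bwd∘fwd = λ Px → trans (cong (bwd i) (bwd∘fwd j (fwd-∈ i Px))) (bwd∘fwd i Px)
  ; fwd∘bwd = λ Rz → trans (cong (fwd j) (fwd∘bwd i (bwd-∈ j Rz))) (fwd∘bwd j Rz)
  }

⇔⇒≅ : {P Q : Pred X 0ℓ} → (∀ {x} → P x → Q x) → (∀ {x} → Q x → P x) → P ≅ Q
⇔⇒≅ P⇒Q Q⇒P = record { fwd = id ; bwd = id ; fwd-∈ = P⇒Q ; bwd-∈ = Q⇒P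
                      ; bwd∘fwd = λ _ → refl ; fwd∘bwd = λ _ → refl }

-- The Boolean supplies the factor 2 in `2 * A n`; later it records whether a part 0 is present.
Marked : Pred X 0ℓ → Pred (Bool × X) 0ℓ
Marked P (_ , x) = P x

marked-≅ : P ≅ Q → Marked P ≅ Marked Q
marked-≅ i = record
  { fwd     = map₂ (fwd i)
  ; bwd     = map₂ (bwd i)
  ; fwd-∈   = fwd-∈ i
  ; bwd-∈   = bwd-∈ i
  ; bwd∘fwd = cong (_ ,_) ∘ bwd∘fwd i
  ; fwd∘bwd = cong (_ ,_) ∘ fwd∘bwd i
  }

card-≤ : (eP : Enumeration P) (eQ : Enumeration Q) → P ≅ Q → card eP ≤ card eQ
card-≤ eP eQ i = begin
  length (elements eP)                ≡⟨ length-map (fwd i) (elements eP) ⟨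
  length (map (fwd i) (elements eP))  ≤⟨ unique-⊆⇒length≤ (unique-map (elements eP) inj (unique eP)) ⊆Q ⟩
  length (elements eQ)                ∎
  where
  open ≤-Reasoning
  inj : ∀ {x y} → x ∈ elements eP → y ∈ elements eP → fwd i x ≡ fwd i y → x ≡ y
  inj x∈ y∈ eq = trans (sym (bwd∘fwd i (to (∈⇔ eP) x∈)))
                       (trans (cong (bwd i) eq) (bwd∘fwd i (to (∈⇔ eP) y∈)))
  ⊆Q : ∀ {y} → y ∈ map (fwd i) (elements eP) → y ∈ elements eQ
  ⊆Q y∈ with x , x∈ , refl ← ∈-map⁻ (fwd i) y∈ = from (∈⇔ eQ) (fwd-∈ i (to (∈⇔ eP) x∈))

card-≅ : (eP : Enumeration P) (eQ : Enumeration Q) → P ≅ Q → card eP ≡ card eQ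
card-≅ eP eQ i = ≤-antisym (card-≤ eP eQ i) (card-≤ eQ eP (≅-sym i))

length-cartesianProduct : (xs : List X) (ys : List Y) →
                          length (cartesianProduct xs ys) ≡ length xs * length ys
length-cartesianProduct []       ys = refl
length-cartesianProduct (x ∷ xs) ys =
  trans (length-++ (map (x ,_) ys)) (cong₂ _+_ (length-map (x ,_) ys) (length-cartesianProduct xs ys))

double : Enumeration P → Enumeration (Marked P)
double e = record
  { elements = cartesianProduct bools (elements e)
  ; unique   = cartesianProduct⁺ (((λ ()) ∷ []) ∷ [] ∷ []) (unique e)
  ; ∈⇔       = mk⇔ (λ bx∈ → to (∈⇔ e) (proj₂ (∈-cartesianProduct⁻ bools (elements e) bx∈)))
                   (λ Px → ∈-cartesianProduct⁺ (∈bools _) (from (∈⇔ e) Px))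
  }
  where
  bools = true ∷ false ∷ []
  ∈bools : ∀ b → b ∈ bools
  ∈bools true  = here refl
  ∈bools false = there (here refl)

card-double : (e : Enumeration P) → card (double e) ≡ 2 * card e
card-double e = length-cartesianProduct (true ∷ false ∷ []) (elements e)

-- Multiplicities

mult-head : ∀ x p → multiplicity x (x ∷ p) ≡ suc (multiplicity x p)
mult-head x p = cong length (filter-accept (x ≟_) {x = x} {xs = p} refl)

mult-tail : ∀ p → x ≢ y → multiplicity x (y ∷ p) ≡ multiplicity x p
mult-tail p x≢y = cong length (filter-reject (_ ≟_) x≢y)

mult-tail-≤ : ∀ x y p → multiplicity x p ≤ multiplicity x (y ∷ p)
mult-tail-≤ x y p with x ≟ y
... | yes refl = ≤-trans (n≤1+n _) (≤-reflexive (sym (mult-head x p)))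
... | no  x≢y  = ≤-reflexive (sym (mult-tail p x≢y))

∈⇒mult>0 : x ∈ p → 0 < multiplicity x p
∈⇒mult>0 {x} {p = y ∷ p} (here refl) = subst (0 <_) (sym (mult-head x p)) (s≤s z≤n)
∈⇒mult>0 {x} {p = y ∷ p} (there x∈)  = ≤-trans (∈⇒mult>0 x∈) (mult-tail-≤ x y p)

mult>0⇒∈ : 0 < multiplicity x p → x ∈ p
mult>0⇒∈ {x} {y ∷ p} 0< with x ≟ y
... | yes refl = here refl
... | no  x≢y  = there (mult>0⇒∈ (subst (0 <_) (mult-tail p x≢y) 0<))

∉⇒mult≡0 : x ∉ p → multiplicity x p ≡ 0
∉⇒mult≡0 {x} {p} x∉ with multiplicity x p in eq
... | zero  = refl
... | suc _ = contradiction (mult>0⇒∈ (subst (0 <_) (sym eq) (s≤s z≤n))) x∉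

mult≡0⇒∉ : multiplicity x p ≡ 0 → x ∉ p
mult≡0⇒∉ eq x∈ = n≮n 0 (subst (0 <_) eq (∈⇒mult>0 x∈))

mult-++ : ∀ x p q → multiplicity x (p ++ q) ≡ multiplicity x p + multiplicity x q
mult-++ x p q = trans (cong length (filter-++ (x ≟_) p q)) (length-++ (filter (x ≟_) p))

mult-replicate-≡ : ∀ n x → multiplicity x (replicate n x) ≡ n
mult-replicate-≡ zero    x = refl
mult-replicate-≡ (suc n) x = trans (mult-head x (replicate n x)) (cong suc (mult-replicate-≡ n x))

mult-replicate-≢ : ∀ n → x ≢ y → multiplicity x (replicate n y) ≡ 0
mult-replicate-≢ zero    x≢y = refl
mult-replicate-≢ (suc n) x≢y = trans (mult-tail (replicate n _) x≢y) (mult-replicate-≢ n x≢y)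

mult-↭ : p ↭ q → multiplicity x p ≡ multiplicity x q
mult-↭ {x = x} p↭q = ↭-length (filter-↭ (x ≟_) p↭q)

module _ {Q : Pred ℕ 0ℓ} (Q? : Decidable Q) where

  mult-filter-∈ : ∀ p → Q x → multiplicity x (filter Q? p) ≡ multiplicity x p
  mult-filter-∈ []      Qx = refl
  mult-filter-∈ {x} (y ∷ p) Qx with x ≟ y
  ... | yes refl = begin
    multiplicity x (filter Q? (x ∷ p))    ≡⟨ cong (multiplicity x) (filter-accept Q? Qx) ⟩
    multiplicity x (x ∷ filter Q? p)      ≡⟨ mult-head x (filter Q? p) ⟩
    suc (multiplicity x (filter Q? p))    ≡⟨ cong suc (mult-filter-∈ p Qx) ⟩
    suc (multiplicity x p)                ≡⟨ mult-head x p ⟨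
    multiplicity x (x ∷ p)                ∎
    where open ≡-Reasoning
  ... | no x≢y with Q? y
  ...   | yes _ = trans (mult-tail (filter Q? p) x≢y)
                       (trans (mult-filter-∈ p Qx) (sym (mult-tail p x≢y)))
  ...   | no  _ = trans (mult-filter-∈ p Qx) (sym (mult-tail p x≢y))

  mult-filter-∉ : ∀ p → ¬ Q x → multiplicity x (filter Q? p) ≡ 0
  mult-filter-∉ p ¬Qx = ∉⇒mult≡0 (λ x∈ → ¬Qx (proj₂ (∈-filter⁻ Q? {xs = p} x∈)))

unique⇒mult≤1 : Unique p → ∀ x → multiplicity x p ≤ 1
unique⇒mult≤1 [] x = z≤n
unique⇒mult≤1 {y ∷ p} (y∉ ∷ u) x with x ≟ y
... | yes refl = ≤-reflexive (trans (mult-head x p) (cong suc (∉⇒mult≡0 (λ x∈ → All.lookup y∉ x∈ refl))))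
... | no  x≢y  = subst (_≤ 1) (sym (mult-tail p x≢y)) (unique⇒mult≤1 u x)

mult≤1⇒unique : (∀ x → multiplicity x p ≤ 1) → Unique p
mult≤1⇒unique {[]}    _  = []
mult≤1⇒unique {y ∷ p} ≤1 =
  All.tabulate (λ { x∈ refl → n≮n 1 (≤-trans (s≤s (∈⇒mult>0 x∈))
                                             (subst (_≤ 1) (mult-head y p) (≤1 y))) })
  ∷ mult≤1⇒unique (λ x → ≤-trans (mult-tail-≤ x y p) (≤1 x))

-- Weakly decreasing lists

head-≥ : Linked _≥_ (x ∷ p) → All (_≤ x) p
head-≥ s with x≥ ∷ _ ← Linked⇒AllPairs (λ a≥b b≥c → ≤-trans b≥c a≥b) s = x≥

cons-≥ : All (_≤ x) p → Linked _≥_ p → Linked _≥_ (x ∷ p)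
cons-≥ []        []         = [-]
cons-≥ (y≤x ∷ _) s          = y≤x ∷ s

∈-≤-head : Linked _≥_ (x ∷ p) → y ∈ x ∷ p → y ≤ x
∈-≤-head s = All.lookup (≤-refl ∷ head-≥ s)

-- Each head occurs in the other list and so is at most the other head; hence the heads agree and
-- can be removed. Equality of partitions is thereby reduced to arithmetic of multiplicities, which
-- is how the steps of Glaisher's bijection are verified.
sorted-mult-unique : Linked _≥_ p → Linked _≥_ q →
                     (∀ x → multiplicity x p ≡ multiplicity x q) → p ≡ q
sorted-mult-unique {[]}    {[]}    _ _ _  = refl
sorted-mult-unique {[]}    {y ∷ q} _ _ eq = contradiction (trans (eq y) (mult-head y q)) λ ()
sorted-mult-unique {x ∷ p} {[]}    _ _ eq = contradiction (trans (sym (eq x)) (mult-head x p)) λ ()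
sorted-mult-unique {x ∷ p} {y ∷ q} sp sq eq
  with refl ← ≤-antisym {x} {y}
    (∈-≤-head sq (mult>0⇒∈ (subst (0 <_) (eq x) (∈⇒mult>0 {p = x ∷ p} (here refl)))))
    (∈-≤-head sp (mult>0⇒∈ (subst (0 <_) (sym (eq y)) (∈⇒mult>0 {p = y ∷ q} (here refl)))))
  = cong (x ∷_) (sorted-mult-unique (Linked.tail sp) (Linked.tail sq) eq′)
  where
  eq′ : ∀ z → multiplicity z p ≡ multiplicity z q
  eq′ z with z ≟ x
  ... | yes refl = suc-injective (trans (sym (mult-head z p)) (trans (eq z) (mult-head z q)))
  ... | no  z≢x  = trans (sym (mult-tail p z≢x)) (trans (eq z) (mult-tail q z≢x))

-- Glaisher's bijection

-- Both directions of a Glaisher step only change the multiplicities of two parts. `put r s`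
-- prescribes these as `r` and `s` and keeps every other multiplicity.
module Regroup (a b : ℕ) (a≢b : a ≢ b) where

  Other : Pred ℕ 0ℓ
  Other x = x ≢ a × x ≢ b

  other? : Decidable Other
  other? x = ¬? (x ≟ a) ×-dec ¬? (x ≟ b)

  others : List ℕ → List ℕ
  others = filter other?

  unsorted : ℕ → ℕ → List ℕ → List ℕ
  unsorted r s p = replicate r a ++ replicate s b ++ others p

  sum-replicate : ∀ n x → sum (replicate n x) ≡ n * x
  sum-replicate zero    x = refl
  sum-replicate (suc n) x = cong (x +_) (sum-replicate n x)

  -- Sorting stays opaque: the rest uses only the order, the multiplicities and the sum of the
  -- result.
  abstract
    put : ℕ → ℕ → List ℕ → List ℕ
    put r s p = sort (unsorted r s p)

    put-sorted : ∀ r s p → Linked _≥_ (put r s p)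
    put-sorted r s p = sort-↗ (unsorted r s p)

    mult-put : ∀ r s p x → multiplicity x (put r s p) ≡
               multiplicity x (replicate r a) + (multiplicity x (replicate s b) + multiplicity x (others p))
    mult-put r s p x = trans (mult-↭ (sort-↭ (unsorted r s p)))
      (trans (mult-++ x (replicate r a) _)
             (cong (multiplicity x (replicate r a) +_) (mult-++ x (replicate s b) _)))

    sum-put : ∀ r s p → sum (put r s p) ≡ (r * a + s * b) + sum (others p)
    sum-put r s p = begin
      sum (put r s p)                                        ≡⟨ sum-↭ (sort-↭ (unsorted r s p)) ⟩
      sum (unsorted r s p)                                   ≡⟨ sum-++ (replicate r a) _ ⟩
      sum (replicate r a) + sum (replicate s b ++ others p)  ≡⟨ cong₂ _+_ (sum-replicate r a) (sum-++ (replicate s b) (others p)) ⟩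
      r * a + (sum (replicate s b) + sum (others p))         ≡⟨ cong (λ t → r * a + (t + sum (others p))) (sum-replicate s b) ⟩
      r * a + (s * b + sum (others p))                       ≡⟨ +-assoc (r * a) (s * b) (sum (others p)) ⟨
      (r * a + s * b) + sum (others p)                       ∎
      where open ≡-Reasoning

  mult-a : ∀ r s p → multiplicity a (put r s p) ≡ r
  mult-a r s p = trans (mult-put r s p a) (trans
    (cong₂ _+_ (mult-replicate-≡ r a)
      (cong₂ _+_ (mult-replicate-≢ s a≢b) (mult-filter-∉ other? p (λ (a≢a , _) → a≢a refl))))
    (+-identityʳ r))

  mult-b : ∀ r s p → multiplicity b (put r s p) ≡ s
  mult-b r s p = trans (mult-put r s p b) (trans
    (cong₂ _+_ (mult-replicate-≢ r (≢-sym a≢b))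
      (cong₂ _+_ (mult-replicate-≡ s b) (mult-filter-∉ other? p (λ (_ , b≢b) → b≢b refl))))
    (+-identityʳ s))

  mult-other : ∀ r s p → Other x → multiplicity x (put r s p) ≡ multiplicity x p
  mult-other r s p o@(x≢a , x≢b) = trans (mult-put r s p _)
    (cong₂ _+_ (mult-replicate-≢ r x≢a)
      (cong₂ _+_ (mult-replicate-≢ s x≢b) (mult-filter-∈ other? p o)))

  data View (x : ℕ) : Set where
    is-a  : x ≡ a → View x
    is-b  : x ≡ b → View x
    other : Other x → View x

  view : ∀ x → View x
  view x with x ≟ a | x ≟ b
  ... | yes x≡a | _       = is-a x≡a
  ... | no  _   | yes x≡b = is-b x≡b
  ... | no  x≢a | no  x≢b = other (x≢a , x≢b)

  ≡-by-mult : Linked _≥_ p → Linked _≥_ q →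
              multiplicity a p ≡ multiplicity a q → multiplicity b p ≡ multiplicity b q →
              (∀ {x} → Other x → multiplicity x p ≡ multiplicity x q) → p ≡ q
  ≡-by-mult sp sq eqa eqb eqo = sorted-mult-unique sp sq λ x → case view x of λ where
    (is-a refl) → eqa
    (is-b refl) → eqb
    (other o)   → eqo o

  put-id : Linked _≥_ p → put (multiplicity a p) (multiplicity b p) p ≡ p
  put-id {p} sp = ≡-by-mult (put-sorted _ _ p) sp (mult-a _ _ p) (mult-b _ _ p) (mult-other _ _ p)

  -- By `put-id`, `p` is itself a `put`, so both sums consist of a contribution of `a` and `b` and
  -- the same sum over the other parts.
  sum-put-≡ : ∀ r s → Linked _≥_ p →
              r * a + s * b ≡ multiplicity a p * a + multiplicity b p * b → sum (put r s p) ≡ sum p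
  sum-put-≡ {p} r s sp eq = begin
    sum (put r s p)                                    ≡⟨ sum-put r s p ⟩
    (r * a + s * b) + sum (others p)            ≡⟨ cong (_+ sum (others p)) eq ⟩
    (multiplicity a p * a + multiplicity b p * b) + sum (others p)
                                                       ≡⟨ sum-put _ _ p ⟨
    sum (put (multiplicity a p) (multiplicity b p) p)  ≡⟨ cong sum (put-id sp) ⟩
    sum p                                              ∎
    where open ≡-Reasoning

  put-All : ∀ {Q : Pred ℕ 0ℓ} r s → (0 < r → Q a) → (0 < s → Q b) →
            (∀ {x} → x ∈ p → Other x → Q x) → ∀ {x} → x ∈ put r s p → Q x
  put-All {p} r s Qa Qb Qo {x} x∈ with view x
  ... | is-a refl = Qa (subst (0 <_) (mult-a r s p) (∈⇒mult>0 x∈))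
  ... | is-b refl = Qb (subst (0 <_) (mult-b r s p) (∈⇒mult>0 x∈))
  ... | other o   = Qo (mult>0⇒∈ (subst (0 <_) (mult-other r s p o) (∈⇒mult>0 x∈))) o

-- Parity of neighbouring numbers

∤-suc : Even x → Odd (suc x)
∤-suc {x} 2∣x 2∣1+x with ∣1⇒≡1 (∣m+n∣m⇒∣n (subst (2 ∣_) (+-comm 1 x) 2∣1+x) 2∣x)
... | ()

even-or-odd : ∀ x → Even x ⊎ Even (suc x)
even-or-odd zero    = inj₁ (2 ∣0)
even-or-odd (suc x) with even-or-odd x
... | inj₁ 2∣x   = inj₂ (∣m∣n⇒∣m+n (∣-refl {2}) 2∣x)
... | inj₂ 2∣1+x = inj₁ 2∣1+x

odd⇒even-suc : Odd x → Even (suc x)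
odd⇒even-suc {x} odd with even-or-odd x
... | inj₁ 2∣x   = contradiction 2∣x odd
... | inj₂ 2∣1+x = 2∣1+x

odd⇒even-pred : Odd (suc x) → Even x
odd⇒even-pred {x} odd with even-or-odd x
... | inj₁ 2∣x   = 2∣x
... | inj₂ 2∣1+x = contradiction 2∣1+x odd

-- Interpolates between odd parts (k = 0) and distinct parts (k large).
record Stage (k L n : ℕ) (p : List ℕ) : Set where
  field
    partition : IsPartition n p
    bounded   : ∀ {x} → x ∈ p → x ≤ L
    odd-above : ∀ {x} → x ∈ p → x ≤ 2 * k ⊎ Odd x
    distinct  : ∀ {x} → x ≤ k → multiplicity x p ≤ 1

  sorted : Linked _≥_ p
  sorted = proj₁ (proj₁ partition)

  positive : ∀ {x} → x ∈ p → 0 < x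
  positive = All.lookup (proj₂ partition)

-- One step trades pairs of copies of `a` for copies of `b`. The hypothesis `2a≤L` lets the new part
-- `b` respect the bound `L`.
module Step (k L n : ℕ) (2a≤L : 2 * suc k ≤ L) where
  a = suc k
  b = 2 * a

  a<b : a < b
  a<b = s≤s (m<m+n k (s≤s z≤n))

  open Regroup a b (<⇒≢ a<b)

  split merge : List ℕ → List ℕ
  split p = put (multiplicity a p % 2) (multiplicity a p / 2) p
  merge p = put (multiplicity a p + multiplicity b p * 2) 0 p

  -- `b` is even and exceeds `2 * k`, so `odd-above` excludes it. Hence `split` starts with no
  -- copies of `b`, and `merge` may remove all of them.
  b-absent : Stage k L n p → multiplicity b p ≡ 0
  b-absent st = ∉⇒mult≡0 λ b∈ → case Stage.odd-above st b∈ of λ where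
    (inj₁ b≤2k) → <⇒≱ (*-monoʳ-< 2 (n<1+n k)) b≤2k
    (inj₂ odd)  → odd (m∣m*n a)

  a-distinct : Stage (suc k) L n p → multiplicity a p ≤ 1
  a-distinct st = Stage.distinct st ≤-refl

  regroup : ∀ r s → r * a + s * b ≡ (r + s * 2) * a
  regroup r s = trans (cong (r * a +_) (sym (*-assoc s 2 a))) (sym (*-distribʳ-+ a r (s * 2)))

  split-∈ : Stage k L n p → Stage (suc k) L n (split p)
  split-∈ {p} st = record
    { partition = (put-sorted r s p , trans sum≡ (proj₂ (proj₁ partition)))
                , All.tabulate (put-All r s (λ _ → s≤s z≤n) (λ _ → s≤s z≤n) (λ x∈ _ → positive x∈))
    ; bounded   = put-All r s (λ _ → ≤-trans (<⇒≤ a<b) 2a≤L) (λ _ → 2a≤L) (λ x∈ _ → bounded x∈)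
    ; odd-above = put-All r s (λ _ → inj₁ (<⇒≤ a<b)) (λ _ → inj₁ ≤-refl)
        (λ x∈ _ → [ (λ x≤2k → inj₁ (≤-trans x≤2k (*-monoʳ-≤ 2 (n≤1+n k)))) , inj₂ ]′ (odd-above x∈))
    ; distinct  = λ {x} → distinct′ x
    }
    where
    open Stage st
    r = multiplicity a p % 2
    s = multiplicity a p / 2
    sum≡ : sum (split p) ≡ sum p
    sum≡ = sum-put-≡ r s sorted (begin
      r * a + s * b                                ≡⟨ regroup r s ⟩
      (r + s * 2) * a                              ≡⟨ cong (_* a) (m≡m%n+[m/n]*n (multiplicity a p) 2) ⟨
      multiplicity a p * a                         ≡⟨ +-identityʳ _ ⟨
      multiplicity a p * a + 0 * b                 ≡⟨ cong (λ t → multiplicity a p * a + t * b) (b-absent st) ⟨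
      multiplicity a p * a + multiplicity b p * b  ∎)
      where open ≡-Reasoning
    distinct′ : ∀ x → x ≤ suc k → multiplicity x (split p) ≤ 1
    distinct′ x x≤a with view x
    ... | is-a refl = subst (_≤ 1) (sym (mult-a r s p)) (≤-pred (m%n<n (multiplicity a p) 2))
    ... | is-b refl = contradiction x≤a (<⇒≱ a<b)
    ... | other o   = subst (_≤ 1) (sym (mult-other r s p o)) (distinct (≤-pred (≤∧≢⇒< x≤a (proj₁ o))))

  merge-∈ : Stage (suc k) L n p → Stage k L n (merge p)
  merge-∈ {p} st = record
    { partition = (put-sorted r 0 p , trans sum≡ (proj₂ (proj₁ partition)))
                , All.tabulate (put-All r 0 (λ _ → s≤s z≤n) (λ ()) (λ x∈ _ → positive x∈))
    ; bounded   = put-All r 0 (λ _ → ≤-trans (<⇒≤ a<b) 2a≤L) (λ ()) (λ x∈ _ → bounded x∈)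
    ; odd-above = put-All r 0 (λ _ → a-small k) (λ ()) odd-above′
    ; distinct  = λ {x} x≤k → subst (_≤ 1)
        (sym (mult-other r 0 p (<⇒≢ (s≤s x≤k) , <⇒≢ (<-trans (s≤s x≤k) a<b))))
        (distinct (m≤n⇒m≤1+n x≤k))
    }
    where
    open Stage st
    r = multiplicity a p + multiplicity b p * 2
    sum≡ : sum (merge p) ≡ sum p
    sum≡ = sum-put-≡ r 0 sorted
      (trans (+-identityʳ _) (sym (regroup (multiplicity a p) (multiplicity b p))))
    -- The merged part `suc k` exceeds `2 * k` only for `k = 0`, and then it is the odd number 1.
    a-small : ∀ k → suc k ≤ 2 * k ⊎ Odd (suc k)
    a-small zero    = inj₂ (∤-suc (2 ∣0))
    a-small (suc k) = inj₁ (s≤s (m<m+n k (s≤s z≤n)))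
    odd-above′ : x ∈ p → Other x → x ≤ 2 * k ⊎ Odd x
    odd-above′ {x} x∈ (_ , x≢b) with odd-above x∈
    ... | inj₂ odd = inj₂ odd
    -- A part that is at most `b` and differs from it is at most `2 * k + 1`: it is either at most
    -- `2 * k` or equal to this odd number.
    ... | inj₁ x≤b with m≤n⇒m<n∨m≡n (≤-pred (subst (x <_) (*-suc 2 k) (≤∧≢⇒< x≤b x≢b)))
    ...   | inj₁ x<   = inj₁ (≤-pred x<)
    ...   | inj₂ refl = inj₂ (∤-suc (m∣m*n k))

  merge∘split : Stage k L n p → merge (split p) ≡ p
  merge∘split {p} st = ≡-by-mult (put-sorted _ 0 (split p)) (Stage.sorted st)
    (begin
      multiplicity a (merge (split p))                                ≡⟨ mult-a _ 0 (split p) ⟩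
      multiplicity a (split p) + multiplicity b (split p) * 2         ≡⟨ cong₂ (λ u v → u + v * 2) (mult-a _ _ p) (mult-b _ _ p) ⟩
      multiplicity a p % 2 + multiplicity a p / 2 * 2                 ≡⟨ m≡m%n+[m/n]*n (multiplicity a p) 2 ⟨
      multiplicity a p                                                ∎)
    (trans (mult-b _ 0 (split p)) (sym (b-absent st)))
    (λ o → trans (mult-other _ 0 (split p) o) (mult-other _ _ p o))
    where open ≡-Reasoning

  -- There is at most one copy of `a`, so the multiplicities `u` and `v` are exactly the remainder
  -- and the quotient of `u + v * 2` by 2.
  split∘merge : Stage (suc k) L n p → split (merge p) ≡ p
  split∘merge {p} st = ≡-by-mult (put-sorted _ _ (merge p)) (Stage.sorted st)
    (begin
      multiplicity a (split (merge p))  ≡⟨ mult-a _ _ (merge p) ⟩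
      multiplicity a (merge p) % 2      ≡⟨ cong (_% 2) (mult-a _ 0 p) ⟩
      (u + v * 2) % 2                   ≡⟨ [m+kn]%n≡m%n u v 2 ⟩
      u % 2                             ≡⟨ m<n⇒m%n≡m (s≤s (a-distinct st)) ⟩
      u                                 ∎)
    (begin
      multiplicity b (split (merge p))  ≡⟨ mult-b _ _ (merge p) ⟩
      multiplicity a (merge p) / 2      ≡⟨ cong (_/ 2) (mult-a _ 0 p) ⟩
      (u + v * 2) / 2                   ≡⟨ +-distrib-/-∣ʳ u (divides v refl) ⟩
      u / 2 + v * 2 / 2                 ≡⟨ cong₂ _+_ (m<n⇒m/n≡0 (s≤s (a-distinct st))) (m*n/n≡m v 2) ⟩
      v                                 ∎)
    (λ o → trans (mult-other _ _ (merge p) o) (mult-other _ 0 p o))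
    where
    open ≡-Reasoning
    u = multiplicity a p
    v = multiplicity b p

  step : Stage k L n ≅ Stage (suc k) L n
  step = record { fwd = split ; bwd = merge ; fwd-∈ = split-∈ ; bwd-∈ = merge-∈
                ; bwd∘fwd = merge∘split ; fwd∘bwd = split∘merge }

-- The largest part created by the first `k` steps is at most `2 * k`, so this one bound on `L`
-- serves all of them.
glaisher : ∀ k L n → 2 * k ≤ L → Stage 0 L n ≅ Stage k L n
glaisher zero    L n _    = ⇔⇒≅ id id
glaisher (suc k) L n 2k≤L =
  ≅-trans (glaisher k L n (≤-trans (*-monoʳ-≤ 2 (n≤1+n k)) 2k≤L)) (Step.step k L n 2k≤L)

-- No part exceeds `n`, so at stage `n` the condition `odd-above` is automatic and `distinct`
-- reaches every part. The bound `2 * n` is the least that `glaisher n` accepts.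
partA≅stage : ∀ n → PartA n ≅ Stage n (2 * n) n
partA≅stage n = ⇔⇒≅ to′ from′
  where
  part≤n : IsPartition n p → x ∈ p → x ≤ n
  part≤n {p} ((_ , refl) , _) = All.lookup (part≤sum p)
  to′ : PartA n p → Stage n (2 * n) n p
  to′ (part , u) = record
    { partition = part
    ; bounded   = λ x∈ → ≤-trans (part≤n part x∈) (m≤n*m n 2)
    ; odd-above = λ x∈ → inj₁ (≤-trans (part≤n part x∈) (m≤n*m n 2))
    ; distinct  = λ _ → unique⇒mult≤1 u _
    }
  from′ : Stage n (2 * n) n p → PartA n p
  from′ {p} st = partition , mult≤1⇒unique mult≤1
    where
    open Stage st
    mult≤1 : ∀ x → multiplicity x p ≤ 1
    mult≤1 x with x ≤? n
    ... | yes x≤n = distinct x≤n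
    ... | no  x≰n = subst (_≤ 1) (sym (∉⇒mult≡0 (λ x∈ → x≰n (part≤n partition x∈)))) z≤n

stage-0-distinct : IsPartition n p → x ≤ 0 → multiplicity x p ≤ 1
stage-0-distinct (_ , 0<p) z≤n =
  subst (_≤ 1) (sym (∉⇒mult≡0 (λ 0∈ → n≮n 0 (All.lookup 0<p 0∈)))) z≤n

stage-0-odd : Stage 0 m n p → All Odd p
stage-0-odd st = All.tabulate (λ x∈ →
  [ (λ x≤0 → contradiction (≤-trans (Stage.positive st x∈) x≤0) (n≮n 0)) , id ]′ (Stage.odd-above st x∈))

partB≅stage : ∀ n → PartB n ≅ Stage 0 (2 * n) n
partB≅stage n = ⇔⇒≅ to′ (λ st → Stage.partition st , stage-0-odd st)
  where
  to′ : PartB n p → Stage 0 (2 * n) n p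
  to′ {p} (part@((_ , refl) , _) , odd) = record
    { partition = part
    ; bounded   = λ x∈ → ≤-trans (All.lookup (part≤sum p) x∈) (m≤n*m n 2)
    ; odd-above = inj₂ ∘ All.lookup odd
    ; distinct  = stage-0-distinct part
    }

A≡B : ∀ n → A n ≡ B n
A≡B n = card-≅ (enumA n) (enumB n)
  (≅-trans (partA≅stage n) (≅-trans (≅-sym (glaisher n (2 * n) n ≤-refl)) (≅-sym (partB≅stage n))))

-- Partitions with a distinguished largest part

largest≡head : Linked _≥_ (x ∷ p) → IsLargest (x ∷ p) m → m ≡ x
largest≡head s (m∈ , x≤m ∷ _) = ≤-antisym (∈-≤-head s m∈) x≤m

head-largest : Linked _≥_ (x ∷ p) → IsLargest (x ∷ p) x
head-largest s = here refl , ≤-refl ∷ head-≥ s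

IsPartition-∷ : ∀ {m q} → All (_≤ m) q → 0 < m → m ≤ n → IsPartition (n ∸ m) q → IsPartition n (m ∷ q)
IsPartition-∷ {m = m} q≤m 0<m m≤n ((s , sum≡) , 0<q) =
  (cons-≥ q≤m s , trans (cong (m +_) sum≡) (m+[n∸m]≡n m≤n)) , 0<m ∷ 0<q

IsPartition-tail : ∀ {m q} → IsPartition n (m ∷ q) → IsPartition (n ∸ m) q
IsPartition-tail {m = m} {q} ((s , refl) , _ ∷ 0<q) = (Linked.tail s , sym (m+n∸m≡n m (sum q))) , 0<q

head≤n : ∀ {m q} → IsPartition n (m ∷ q) → m ≤ n
head≤n {m = m} {q} ((_ , refl) , _) = m≤m+n m (sum q)

-- In a decreasing list the largest part is the head, and occurring once means that the tail lies
-- strictly below it. The parameter `Par` is `Even` for F and `Odd` for E.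
Top : (ℕ → Set) → ℕ → List ℕ → Set
Top Par n []      = ⊥
Top Par n (m ∷ q) = IsPartition n (m ∷ q) × Par m × All (_< m) q × All Odd q

top⇒ : ∀ {Par} p → Top Par n p → IsPartition n p ×
  ∃ λ m → IsLargest p m × Par m × multiplicity m p ≡ 1 × All (λ x → x ≢ m → Odd x) p
top⇒ (m ∷ q) (part@((s , _) , _) , par , q<m , odd) =
  part , m , head-largest s , par ,
  trans (mult-head m q) (cong suc (∉⇒mult≡0 (λ m∈ → n≮n m (All.lookup q<m m∈)))) ,
  (λ m≢m → contradiction refl m≢m) ∷ All.map (λ o _ → o) odd

top⇐ : ∀ {Par} p → (IsPartition n p ×
  ∃ λ m → IsLargest p m × Par m × multiplicity m p ≡ 1 × All (λ x → x ≢ m → Odd x) p) → Top Par n p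
top⇐ [] (_ , _ , (() , _) , _)
top⇐ (x ∷ q) (part@((s , _) , _) , m , largest , par , once , _ ∷ odd)
  with refl ← largest≡head s largest =
  part , par , All.tabulate (λ y∈ → ≤∧≢⇒< (All.lookup (head-≥ s) y∈) (q≢m y∈)) ,
  All.tabulate (λ y∈ → All.lookup odd y∈ (q≢m y∈))
  where
  q≢m : ∀ {y} → y ∈ q → y ≢ m
  q≢m y∈ refl = mult≡0⇒∉ {p = q} (suc-injective (trans (sym (mult-head m q)) once)) y∈

partF≅top : ∀ n → PartF n ≅ Top Even n
partF≅top n = ⇔⇒≅ (top⇐ _) (top⇒ _)

partE≅top : ∀ n → PartE n ≅ Top Odd n
partE≅top n = ⇔⇒≅ to′ from′
  where
  to′ : PartE n p → Top Odd n p
  to′ (part , odd , m , l , once) =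
    top⇐ _ (part , m , l , All.lookup odd (proj₁ l) , once , All.map (λ o _ → o) odd)
  from′ : Top Odd n p → PartE n p
  from′ {m ∷ q} t@(_ , odd-m , _ , odd) =
    let part , m , l , _ , once , _ = top⇒ {Par = Odd} (m ∷ q) t in part , odd-m ∷ odd , m , l , once

-- Adding 1 to the largest part

onHead : (ℕ → ℕ) → List ℕ → List ℕ
onHead f []      = []
onHead f (x ∷ p) = f x ∷ p

-- `onHead pred` undoes `onHead suc` everywhere, but the converse needs a positive head; `down`
-- supplies that shape together with membership of the preimage.
incHead : (P Q : Pred (List ℕ) 0ℓ) → (∀ p → P p → Q (onHead suc p)) →
          (∀ p → Q p → ∃₂ λ m q → p ≡ suc m ∷ q × P (m ∷ q)) → P ≅ Q
incHead P Q up down = record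
  { fwd     = onHead suc
  ; bwd     = onHead pred
  ; fwd-∈   = up _
  ; bwd-∈   = λ Qp → case down _ Qp of λ { (_ , _ , refl , Pp) → Pp }
  ; bwd∘fwd = λ {p} _ → pred∘suc p
  ; fwd∘bwd = λ Qp → case down _ Qp of λ { (_ , _ , refl , _) → refl }
  }
  where
  pred∘suc : ∀ p → onHead pred (onHead suc p) ≡ p
  pred∘suc []      = refl
  pred∘suc (_ ∷ _) = refl

inc-partition : All (_≤ m) p → IsPartition n (m ∷ p) → IsPartition (suc n) (suc m ∷ p)
inc-partition p≤m ((s , refl) , _ ∷ 0<p) =
  (cons-≥ (All.map m≤n⇒m≤1+n p≤m) (Linked.tail s) , refl) , s≤s z≤n ∷ 0<p

dec-partition : All (_≤ m) p → 0 < m → IsPartition (suc n) (suc m ∷ p) → IsPartition n (m ∷ p)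
dec-partition p≤m 0<m ((s , sum≡) , _ ∷ 0<p) =
  (cons-≥ p≤m (Linked.tail s) , suc-injective sum≡) , 0<m ∷ 0<p

odd⇒>0 : ∀ x → Odd x → 0 < x
odd⇒>0 zero    odd = contradiction (2 ∣0) odd
odd⇒>0 (suc x) _   = s≤s z≤n

-- Raising one copy of the largest odd part makes it even and strictly larger than everything else,
-- including its former copies. Positivity of `n` excludes the empty partition, which has no largest
-- part.
partB≅topEven : ∀ n → 0 < n → PartB n ≅ Top Even (suc n)
partB≅topEven n 0<n = incHead (PartB n) (Top Even (suc n)) up down
  where
  up : ∀ p → PartB n p → Top Even (suc n) (onHead suc p)
  up [] (((_ , sum≡) , _) , _) = contradiction sum≡ (<⇒≢ 0<n)
  up (m ∷ q) (part@((s , _) , _) , odd-m ∷ odd) =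
    inc-partition (head-≥ s) part , odd⇒even-suc odd-m , All.map s≤s (head-≥ s) , odd
  down : ∀ p → Top Even (suc n) p → ∃₂ λ m q → p ≡ suc m ∷ q × PartB n (m ∷ q)
  down (zero  ∷ q) ((_ , () ∷ _) , _)
  down (suc m ∷ q) (part , even , q<m , odd) =
    m , q , refl , dec-partition (All.map ≤-pred q<m) (odd⇒>0 m odd-m) part , odd-m ∷ odd
    where
    odd-m : Odd m
    odd-m 2∣m = ∤-suc 2∣m even

topEven≅topOdd : ∀ n → 0 < n → Top Even (suc n) ≅ Top Odd (2 + n)
topEven≅topOdd n 0<n = incHead (Top Even (suc n)) (Top Odd (2 + n)) up down
  where
  up : ∀ p → Top Even (suc n) p → Top Odd (2 + n) (onHead suc p)
  up (m ∷ q) (part , even , q<m , odd) =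
    inc-partition (All.map <⇒≤ q<m) part , ∤-suc even , All.map m<n⇒m<1+n q<m , odd
  down : ∀ p → Top Odd (2 + n) p → ∃₂ λ m q → p ≡ suc m ∷ q × Top Even (suc n) (m ∷ q)
  down (zero ∷ q)         ((_ , () ∷ _) , _)
  -- A head 1 would be lowered to the forbidden part 0. It cannot occur: alone it sums to less than
  -- `2 + n`, and any further part would have to be 0.
  down (suc zero ∷ [])    (((_ , ()) , _) , _)
  down (suc zero ∷ y ∷ q) ((_ , _ ∷ 0<y ∷ _) , _ , y<1 ∷ _ , _) = contradiction (≤-trans y<1 0<y) (n≮n _)
  down (suc m@(suc _) ∷ q) (part , odd-m , q<m , odd) =
    m , q , refl , dec-partition (All.map <⇒≤ q<m′) (s≤s z≤n) part , even , q<m′ , odd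
    where
    even : Even m
    even = odd⇒even-pred odd-m
    -- Strictness survives the decrement because `m` is even and the other parts are odd.
    q<m′ : All (_< m) q
    q<m′ = All.zipWith (λ (x<1+m , o) → ≤∧≢⇒< (≤-pred x<1+m) (λ { refl → o even })) (q<m , odd)

-- The largest part `m` is set apart, and `K m` counts the Glaisher steps already applied to the
-- rest: none for F, `m / 2` for C. The condition `m ≤ n` makes the truncated subtraction exact.
Led : (ℕ → ℕ) → ℕ → List ℕ → Set
Led K n []      = ⊥
Led K n (m ∷ q) = (0 < m × m ≤ n × Even m) × Stage (K m) m (n ∸ m) q

-- At stage 0 the remaining parts are odd while `m` is even, so the weak bound by `m` is already
-- strict.
topEven≅led : ∀ n → Top Even n ≅ Led (λ _ → 0) n
topEven≅led n = ⇔⇒≅ (to′ _) (from′ _)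
  where
  to′ : ∀ p → Top Even n p → Led (λ _ → 0) n p
  to′ (m ∷ q) (part@(_ , 0<m ∷ _) , even , q<m , odd) = (0<m , head≤n part , even) , record
    { partition = IsPartition-tail part
    ; bounded   = <⇒≤ ∘ All.lookup q<m
    ; odd-above = inj₂ ∘ All.lookup odd
    ; distinct  = stage-0-distinct (IsPartition-tail part)
    }
  from′ : ∀ p → Led (λ _ → 0) n p → Top Even n p
  from′ (m ∷ q) ((0<m , m≤n , even) , st) =
    IsPartition-∷ (All.tabulate bounded) 0<m m≤n partition , even ,
    All.tabulate (λ x∈ → ≤∧≢⇒< (bounded x∈) (λ { refl → All.lookup (stage-0-odd st) x∈ even })) ,
    stage-0-odd st
    where open Stage st

half : Even m → 2 * (m / 2) ≡ m
half {m} even = trans (*-comm 2 (m / 2)) (m/n*n≡m even)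

-- For even `m` and `k = m / 2`, `odd-above` follows from the bound by `m = 2 * k`, and `x ≤ k`
-- means `2 * x ≤ m`, so `distinct` is the requirement on the small parts.
partC≅led : ∀ n → PartC n ≅ Led (_/ 2) n
partC≅led n = ⇔⇒≅ (to′ _) (from′ _)
  where
  small? : ∀ m → Decidable (λ x → 2 * x ≤ m)
  small? m x = 2 * x ≤? m
  to′ : ∀ p → PartC n p → Led (_/ 2) n p
  to′ [] (_ , _ , (() , _) , _)
  to′ (m ∷ q) (part@((s , _) , 0<m ∷ _) , m′ , largest , even , u)
    with refl ← largest≡head s largest = (0<m , head≤n part , even) , record
    { partition = IsPartition-tail part
    ; bounded   = All.lookup (head-≥ s)
    ; odd-above = λ x∈ → inj₁ (subst (_ ≤_) (sym (half even)) (All.lookup (head-≥ s) x∈))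
    ; distinct  = λ {x} x≤m/2 → ≤-trans (mult-tail-≤ x m q)
        (subst (_≤ 1) (mult-filter-∈ (small? m) (m ∷ q) (subst (2 * x ≤_) (half even) (*-monoʳ-≤ 2 x≤m/2)))
          (unique⇒mult≤1 u x))
    }
  from′ : ∀ p → Led (_/ 2) n p → PartC n p
  from′ (m ∷ q) ((0<m , m≤n , even) , st) =
    part , m , head-largest (proj₁ (proj₁ part)) , even , mult≤1⇒unique mult≤1
    where
    open Stage st
    part : IsPartition n (m ∷ q)
    part = IsPartition-∷ (All.tabulate bounded) 0<m m≤n partition
    mult≤1 : ∀ x → multiplicity x (filter (small? m) (m ∷ q)) ≤ 1
    mult≤1 x with small? m x
    ... | no  2x≰m = subst (_≤ 1) (sym (mult-filter-∉ (small? m) (m ∷ q) 2x≰m)) z≤n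
    ... | yes 2x≤m = subst (_≤ 1)
      (sym (trans (mult-filter-∈ (small? m) (m ∷ q) 2x≤m) (mult-tail q x≢m)))
      (distinct (*-cancelˡ-≤ 2 (subst (2 * x ≤_) (sym (half even)) 2x≤m)))
      where
      -- The positive head `m` exceeds its own half, so it is never among the small parts.
      x≢m : x ≢ m
      x≢m refl = <⇒≱ (m<m+n x (subst (0 <_) (sym (+-identityʳ x)) 0<m)) 2x≤m

-- The head is kept, so both directions perform the same number `m / 2` of steps on the tail.
led≅led : ∀ n → Led (λ _ → 0) n ≅ Led (_/ 2) n
led≅led n = record
  { fwd     = λ { [] → [] ; (m ∷ q) → m ∷ fwd (tail≅ m) q }
  ; bwd     = λ { [] → [] ; (m ∷ q) → m ∷ bwd (tail≅ m) q }
  ; fwd-∈   = λ { {m ∷ q} (h , st) → h , fwd-∈ (tail≅ m) st }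
  ; bwd-∈   = λ { {m ∷ q} (h , st) → h , bwd-∈ (tail≅ m) st }
  ; bwd∘fwd = λ { {m ∷ q} (h , st) → cong (m ∷_) (bwd∘fwd (tail≅ m) st) }
  ; fwd∘bwd = λ { {m ∷ q} (h , st) → cong (m ∷_) (fwd∘bwd (tail≅ m) st) }
  }
  where
  tail≅ : ∀ m → Stage 0 m (n ∸ m) ≅ Stage (m / 2) m (n ∸ m)
  tail≅ m = glaisher (m / 2) m (n ∸ m) (≤-trans (≤-reflexive (*-comm 2 (m / 2))) (m/n*n≤m m 2))

B≡F : ∀ n → 0 < n → B n ≡ F (suc n)
B≡F n 0<n = card-≅ (enumB n) (enumF (suc n)) (≅-trans (partB≅topEven n 0<n) (≅-sym (partF≅top (suc n))))

F≡E : ∀ n → 0 < n → F (suc n) ≡ E (2 + n)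
F≡E n 0<n = card-≅ (enumF (suc n)) (enumE (2 + n))
  (≅-trans (partF≅top (suc n)) (≅-trans (topEven≅topOdd n 0<n) (≅-sym (partE≅top (2 + n)))))

F≡C : ∀ n → F n ≡ C n
F≡C n = card-≅ (enumF n) (enumC n)
  (≅-trans (partF≅top n) (≅-trans (topEven≅led n) (≅-trans (led≅led n) (≅-sym (partC≅led n)))))

-- Partitions whose smallest part occurs exactly twice

-- The inductive form of the condition in `PartD`: a strict descent that ends in a doubled last
-- part.
data Twice : List ℕ → Set where
  twice : ∀ m → Twice (m ∷ m ∷ [])
  _∷_   : y < x → Twice (y ∷ p) → Twice (x ∷ y ∷ p)

TwiceD : ℕ → List ℕ → Set
TwiceD n p = Twice p × sum p ≡ n

twice-sorted : Twice p → Linked _≥_ p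
twice-sorted (twice m)       = ≤-refl ∷ [-]
twice-sorted (y<x ∷ t) = <⇒≤ y<x ∷ twice-sorted t

head-> : Linked _≥_ (y ∷ p) → y < x → ∀ {z} → z ∈ y ∷ p → z < x
head-> s y<x z∈ = ≤-<-trans (∈-≤-head s z∈) y<x

twice⇒ : Twice p → ∃ λ m → IsSmallest p m × multiplicity m p ≡ 2 × All (λ x → x ≢ m → multiplicity x p ≡ 1) p
twice⇒ (twice m) =
  m , (here refl , ≤-refl ∷ ≤-refl ∷ []) ,
  trans (mult-head m (m ∷ [])) (cong suc (mult-head m [])) ,
  (λ m≢m → contradiction refl m≢m) ∷ (λ m≢m → contradiction refl m≢m) ∷ []
twice⇒ {x ∷ y ∷ p} (y<x ∷ t) with twice⇒ t
... | m , (m∈ , m≤) , two , one =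
  m , (there m∈ , <⇒≤ (below m∈) ∷ m≤) ,
  trans (mult-tail (y ∷ p) (<⇒≢ (below m∈))) two ,
  (λ _ → trans (mult-head x (y ∷ p)) (cong suc (∉⇒mult≡0 (λ x∈ → n≮n x (below x∈))))) ∷
  All.tabulate (λ z∈ z≢m → trans (mult-tail (y ∷ p) (<⇒≢ (below z∈))) (All.lookup one z∈ z≢m))
  where
  below : ∀ {z} → z ∈ y ∷ p → z < x
  below = head-> (twice-sorted t) y<x

-- If the head is the minimum, the list is exactly the final pair. Otherwise the head occurs once,
-- hence lies strictly above its successor, and the tail inherits the hypotheses.
twice⇐ : ∀ p → Linked _≥_ p → All (m ≤_) p → multiplicity m p ≡ 2 →
         (∀ {x} → x ∈ p → x ≢ m → multiplicity x p ≡ 1) → Twice p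
twice⇐ {m} (x ∷ []) s m≤ two one =
  contradiction (subst (_≤ 1) two (length-filter (m ≟_) (x ∷ []))) (n≮n 1)
twice⇐ {m} (x ∷ y ∷ p) (y≤x ∷ s) (m≤x ∷ m≤y ∷ m≤p) two one with x ≟ m
twice⇐ {m} (x ∷ y ∷ p) (y≤m ∷ s) (_ ∷ m≤y ∷ m≤p) two one | yes refl
  with refl ← ≤-antisym y≤m m≤y = rest p s m≤p (suc-injective (suc-injective
    (trans (sym (trans (mult-head m (m ∷ p)) (cong suc (mult-head m p)))) two)))
  where
  -- A part after the two copies of `m` would lie between `m` and `m` and be a third copy.
  rest : ∀ q → Linked _≥_ (m ∷ q) → All (m ≤_) q → multiplicity m q ≡ 0 → Twice (m ∷ m ∷ q)
  rest []      _         _         _    = twice m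
  rest (z ∷ q) (z≤m ∷ _) (m≤z ∷ _) none with refl ← ≤-antisym z≤m m≤z =
    contradiction (here refl) (mult≡0⇒∉ {p = z ∷ q} none)
twice⇐ {m} (x ∷ y ∷ p) (y≤x ∷ s) (_ ∷ m≤) two one | no x≢m =
  ≤∧≢⇒< y≤x (≢x (here refl)) ∷
  twice⇐ (y ∷ p) s m≤ (trans (sym (mult-tail (y ∷ p) (≢-sym x≢m))) two)
    (λ z∈ z≢m → trans (sym (mult-tail (y ∷ p) (≢x z∈))) (one (there z∈) z≢m))
  where
  ≢x : ∀ {z} → z ∈ y ∷ p → z ≢ x
  ≢x z∈ refl = mult≡0⇒∉ {p = y ∷ p}
    (suc-injective (trans (sym (mult-head x (y ∷ p))) (one (here refl) x≢m))) z∈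

partD≅twice : ∀ n → PartD n ≅ TwiceD n
partD≅twice n = ⇔⇒≅
  (λ ((s , sum≡) , m , (_ , m≤) , two , one) → twice⇐ _ s m≤ two (All.lookup one) , sum≡)
  (λ (t , sum≡) → (twice-sorted t , sum≡) , twice⇒ t)

-- Distinct parts, with and without the part 0

Distinct₀ : ℕ → List ℕ → Set
Distinct₀ n p = Linked _>_ p × sum p ≡ n

Distinct : ℕ → List ℕ → Set
Distinct n p = Distinct₀ n p × All (0 <_) p

partA≅distinct : ∀ n → PartA n ≅ Distinct n
partA≅distinct n = ⇔⇒≅
  (λ (((s , sum≡) , 0<p) , u) →
    (Linked.zipWith (λ (y≤x , x≢y) → ≤∧≢⇒< y≤x (≢-sym x≢y)) (s , AllPairs⇒Linked u) , sum≡) , 0<p)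
  (λ ((s , sum≡) , 0<p) →
    ((Linked.map <⇒≤ s , sum≡) , 0<p) ,
    AllPairs.map (λ y<x → ≢-sym (<⇒≢ y<x)) (Linked⇒AllPairs (λ a>b b>c → <-trans b>c a>b) s))

addZero : Bool × List ℕ → List ℕ
addZero (true  , p) = p ++ 0 ∷ []
addZero (false , p) = p

-- In a strictly decreasing list nothing follows a 0, so discarding the rest loses nothing there.
splitZero : List ℕ → Bool × List ℕ
splitZero []          = false , []
splitZero (zero  ∷ _) = true , []
splitZero (suc x ∷ p) = map₂ (suc x ∷_) (splitZero p)

withZero : ∀ n → Marked (Distinct n) ≅ Distinct₀ n
withZero n = record
  { fwd     = addZero
  ; bwd     = splitZero
  ; fwd-∈   = λ { {true  , p} ((s , sum≡) , 0<p) → snoc s 0<p ,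
                    trans (sum-++ p (0 ∷ [])) (trans (+-identityʳ (sum p)) sum≡)
                ; {false , p} (d , _) → d }
  ; bwd-∈   = λ {p} (s , sum≡) → (sorted p s , trans (sum-split p s) sum≡) , positive p
  ; bwd∘fwd = λ { {true , p} (_ , 0<p) → split∘add-true 0<p ; {false , p} (_ , 0<p) → split∘add-false 0<p }
  ; fwd∘bwd = λ {p} (s , _) → add∘split p s
  }
  where
  snoc : Linked _>_ p → All (0 <_) p → Linked _>_ (p ++ 0 ∷ [])
  snoc []        _           = [-]
  snoc [-]       (0<x ∷ _)   = 0<x ∷ [-]
  snoc (y<x ∷ s) (_ ∷ 0<p)   = y<x ∷ snoc s 0<p
  positive : ∀ p → All (0 <_) (proj₂ (splitZero p))
  positive []          = []
  positive (zero  ∷ p) = []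
  positive (suc x ∷ p) = s≤s z≤n ∷ positive p
  sorted : ∀ p → Linked _>_ p → Linked _>_ (proj₂ (splitZero p))
  sorted []                    _         = []
  sorted (zero  ∷ p)           _         = []
  sorted (suc x ∷ [])          _         = [-]
  sorted (suc x ∷ zero  ∷ p)   _         = [-]
  sorted (suc x ∷ suc y ∷ p)   (y<x ∷ s) = y<x ∷ sorted (suc y ∷ p) s
  sum-split : ∀ p → Linked _>_ p → sum (proj₂ (splitZero p)) ≡ sum p
  sum-split []          _   = refl
  sum-split (zero ∷ []) _   = refl
  sum-split (zero ∷ y ∷ p) (() ∷ _)
  sum-split (suc x ∷ p) s = cong (suc x +_) (sum-split p (Linked.tail s))
  split∘add-true : All (0 <_) p → splitZero (p ++ 0 ∷ []) ≡ (true , p)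
  split∘add-true []                    = refl
  split∘add-true (s≤s {n = x} _ ∷ 0<p) = cong (map₂ (suc x ∷_)) (split∘add-true 0<p)
  split∘add-false : All (0 <_) p → splitZero p ≡ (false , p)
  split∘add-false []                    = refl
  split∘add-false (s≤s {n = x} _ ∷ 0<p) = cong (map₂ (suc x ∷_)) (split∘add-false 0<p)
  add-∷ : ∀ x bp → addZero (map₂ (x ∷_) bp) ≡ x ∷ addZero bp
  add-∷ x (true  , _) = refl
  add-∷ x (false , _) = refl
  add∘split : ∀ p → Linked _>_ p → addZero (splitZero p) ≡ p
  add∘split []             _ = refl
  add∘split (zero ∷ [])    _ = refl
  add∘split (zero ∷ _ ∷ _) (() ∷ _)
  add∘split (suc x ∷ p)    s =
    trans (add-∷ (suc x) (splitZero p)) (cong (suc x ∷_) (add∘split p (Linked.tail s)))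

-- The test `x ≟ suc y` asks whether the incremented last part meets its predecessor; a lone part
-- has none and always receives the two zeros.
raise : List ℕ → List ℕ
raise []              = []
raise (x ∷ [])        = suc x ∷ 0 ∷ 0 ∷ []
raise (x ∷ y ∷ []) with x ≟ suc y
... | yes _ = x ∷ suc y ∷ []
... | no  _ = x ∷ suc y ∷ 0 ∷ 0 ∷ []
raise (x ∷ y ∷ z ∷ p) = x ∷ raise (y ∷ z ∷ p)

-- On `Twice` lists, a 0 with an entry after it begins the final pair of zeros, which is dropped
-- while the part before it is decremented. Otherwise one copy of the final pair is decremented.
lower : List ℕ → List ℕ
lower []                  = []
lower (x ∷ [])            = x ∷ []
lower (x ∷ y ∷ [])        = x ∷ pred y ∷ []
lower (x ∷ zero ∷ z ∷ p)  = pred x ∷ []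
lower (x ∷ suc y ∷ z ∷ p) = x ∷ lower (suc y ∷ z ∷ p)

-- Exposes the first two entries of the recursive result, so that `Twice` can be extended in front
-- and `lower` takes its recursive clause.
raise-head : ∀ x y p → ∃₂ λ z q → raise (x ∷ y ∷ p) ≡ x ∷ z ∷ q
raise-head x y [] with x ≟ suc y
... | yes _ = _ , _ , refl
... | no  _ = _ , _ , refl
raise-head x y (z ∷ []) with y ≟ suc z
... | yes _ = _ , _ , refl
... | no  _ = _ , _ , refl
raise-head x y (z ∷ w ∷ p) = _ , _ , refl

raise-twice : Linked _>_ (x ∷ p) → Twice (raise (x ∷ p))
raise-twice [-] = s≤s z≤n ∷ twice 0
raise-twice {x} {y ∷ []} (y<x ∷ [-]) with x ≟ suc y
... | yes refl = twice x
... | no  x≢1+y = ≤∧≢⇒< y<x (≢-sym x≢1+y) ∷ s≤s z≤n ∷ twice 0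
raise-twice {x} {y ∷ z ∷ p} (y<x ∷ s) with raise (y ∷ z ∷ p) | raise-head y z p | raise-twice s
... | _ | _ , _ , refl | t = y<x ∷ t

sum-raise : ∀ x p → sum (raise (x ∷ p)) ≡ suc (sum (x ∷ p))
sum-raise x [] = refl
sum-raise x (y ∷ []) with x ≟ suc y
... | yes _ = +-suc x (y + 0)
... | no  _ = +-suc x (y + 0)
sum-raise x (y ∷ z ∷ p) = trans (cong (x +_) (sum-raise y (z ∷ p))) (+-suc x _)

lower∘raise : Linked _>_ p → lower (raise p) ≡ p
lower∘raise []  = refl
lower∘raise [-] = refl
lower∘raise {x ∷ y ∷ []} (y<x ∷ [-]) with x ≟ suc y
... | yes _ = refl
... | no  _ = refl
lower∘raise {x ∷ zero ∷ z ∷ p} (_ ∷ () ∷ _)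
lower∘raise {x ∷ suc y ∷ z ∷ p} (y<x ∷ s)
  with raise (suc y ∷ z ∷ p) | raise-head (suc y) z p | lower∘raise s
... | _ | _ , _ , refl | eq = cong (x ∷_) eq

-- The positive sum excludes `0 ∷ 0 ∷ []`, which `lower` would leave with a repeated part.
lower-sorted : Twice p → 0 < sum p → Linked _>_ (lower p)
lower-sorted (twice (suc m)) _ = ≤-refl ∷ [-]
lower-sorted (s≤s _ ∷ twice zero) _ = [-]
lower-sorted (y<x ∷ twice (suc y)) _ = y<x ∷ ≤-refl ∷ [-]
lower-sorted {x ∷ suc y ∷ _} (y<x ∷ _ ∷ twice zero) _ = <-trans (n<1+n y) y<x ∷ [-]
lower-sorted {x ∷ suc y ∷ zero ∷ _} (_ ∷ _ ∷ () ∷ _) _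
lower-sorted {x ∷ suc y ∷ suc z ∷ w ∷ p} (y<x ∷ t) _ = y<x ∷ lower-sorted t (s≤s z≤n)

lower-∷ : ∀ x p → ∃₂ λ y q → lower (x ∷ p) ≡ y ∷ q
lower-∷ x []              = _ , _ , refl
lower-∷ x (y ∷ [])        = _ , _ , refl
lower-∷ x (zero ∷ z ∷ p)  = _ , _ , refl
lower-∷ x (suc y ∷ z ∷ p) = _ , _ , refl

raise∘lower : Twice p → 0 < sum p → raise (lower p) ≡ p
raise∘lower (twice (suc m)) _ with suc m ≟ suc m
... | yes _  = refl
... | no  ≢m = contradiction refl ≢m
raise∘lower (s≤s _ ∷ twice zero) _ = refl
raise∘lower {x ∷ _} (_ ∷ twice (suc y)) _ = cong (x ∷_) (raise∘lower (twice (suc y)) (s≤s z≤n))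
-- The lowered list is `x ∷ y ∷ []` with `suc y < x`, so `raise` finds no coincidence and appends
-- the zeros again.
raise∘lower {x ∷ suc y ∷ _} (y<x ∷ _ ∷ twice zero) _ with x ≟ suc y
... | yes refl = contradiction y<x (n≮n x)
... | no  _    = refl
raise∘lower {x ∷ suc y ∷ zero ∷ _} (_ ∷ _ ∷ () ∷ _) _
raise∘lower {x ∷ suc y ∷ suc z ∷ w ∷ p} (_ ∷ t) _
  with lower (suc z ∷ w ∷ p) | lower-∷ (suc z) (w ∷ p) | raise∘lower t (s≤s z≤n)
... | _ | _ , _ , refl | eq = cong (x ∷_) eq

distinct₀≅twice : ∀ n → 0 < n → Distinct₀ n ≅ TwiceD (suc n)
distinct₀≅twice n 0<n = record
  { fwd     = raise
  ; bwd     = lower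
  ; fwd-∈   = raise-∈ _
  ; bwd-∈   = lower-∈
  ; bwd∘fwd = λ (s , _) → lower∘raise s
  ; fwd∘bwd = λ { (t , sum≡) → raise∘lower t (subst (0 <_) (sym sum≡) (s≤s z≤n)) }
  }
  where
  raise-∈ : ∀ p → Distinct₀ n p → TwiceD (suc n) (raise p)
  -- The empty list has no smallest part to raise; `0 < n` excludes it.
  raise-∈ []      (_ , sum≡) = contradiction sum≡ (<⇒≢ 0<n)
  raise-∈ (x ∷ p) (s , sum≡) = raise-twice s , trans (sum-raise x p) (cong suc sum≡)
  lower-∈ : TwiceD (suc n) p → Distinct₀ n (lower p)
  -- The sum of `lower p` is read off from `sum-raise`, since `raise` leads back to `p`. An empty
  -- `lower p` would force `p` to be empty, with sum 0.
  lower-∈ {p} (t , sum≡) with lower p | lower-sorted t 0<sum | raise∘lower t 0<sum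
    where
    0<sum : 0 < sum p
    0<sum = subst (0 <_) (sym sum≡) (s≤s z≤n)
  ... | []    | _ | r = contradiction (trans (cong sum r) sum≡) λ ()
  ... | x ∷ q | s | r = s , suc-injective (trans (sym (sum-raise x q)) (trans (cong sum r) sum≡))

2A≡D : ∀ n → 0 < n → 2 * A n ≡ D (suc n)
2A≡D n 0<n = trans (sym (card-double (enumA n))) (card-≅ (double (enumA n)) (enumD (suc n))
  (≅-trans (marked-≅ (partA≅distinct n)) (≅-trans (withZero n)
    (≅-trans (distinct₀≅twice n 0<n) (≅-sym (partD≅twice (suc n)))))))

theorem7 : ∀ (n : ℕ) → n > 0 →
    A n ≡ B n
    × B n ≡ C (n + 1)
    × 2 * C (n + 1) ≡ D (n + 1)
    × D (n + 1) ≡ 2 * E (n + 2)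
    × E (n + 2) ≡ F (n + 1)
theorem7 n 0<n rewrite +-comm n 1 | +-comm n 2 =
  A≡B n , B≡C , trans (cong (2 *_) (sym A≡C)) (2A≡D n 0<n) ,
  trans (sym (2A≡D n 0<n)) (cong (2 *_) (trans A≡C (trans (sym (F≡C (suc n))) (F≡E n 0<n)))) ,
  sym (F≡E n 0<n)
  where
  B≡C : B n ≡ C (suc n)
  B≡C = trans (B≡F n 0<n) (F≡C (suc n))
  A≡C : A n ≡ C (suc n)
  A≡C = trans (A≡B n) B≡C
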